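{- The morphisms of theories $J_{\Theta}\colon\Theta\to\Theta_a$, for $\Theta$ ranging over decorated theories, form the components of a natural transformation $J\colon H\Rightarrow U'\circ F'_{\mathrm{exp}}\colon\mathbf{T}_{\mathrm{dec}}\to\mathbf{T}_{\mathrm{eq}}$.
   Context: Size issues are ignored. Theories. A (equational) theory is a category with chosen finite products; its objects are called types and its morphisms terms. $\mathbf{T}_{\mathrm{eq}}$ is the category of theories and functors strictly preserving the chosen finite products. The chosen terminal type is denoted $1$, and $1\times X$ is identified with $X$ via the canonical isomorphism. Decorated theories. A decorated theory is a theory $\Theta$ together with a wide subtheory $\Theta_0$ (a subcategory with the same types, containing all identities and chosen projections, closed under composition and tuples, with the same chosen products). Terms of $\Theta_0$ are called pure. A morphism of decorated theories is a morphism of theories mapping pure terms to pure terms. This gives the category $\mathbf{T}_{\mathrm{dec}}$. The functor $H\colon\mathbf{T}_{\mathrm{dec}}\to\mathbf{T}_{\mathrm{eq}}$ maps a decorated theory $(\Theta,\Theta_0)$ to the theory $\Theta$. Parameterized theories and theories with a parameter. $\Pi_A$ is the theory freely generated by a type $A$; $\Pi_a$ is the theory freely generated by a type $A$ and a term $a\colon 1\to A$; $i_A\colon\Pi_A\to\Pi_a$ is the inclusion. $\mathbf{T}_A=\Pi_A\downarrow\mathbf{T}_{\mathrm{eq}}$ and $\mathbf{T}_a=\Pi_a\downarrow\mathbf{T}_{\mathrm{eq}}$ are the coslice categories (theories with a distinguished type $A$, respectively with a distinguished type $A$ and a distinguished constant $a\colon 1\to A$). $U'\colon\mathbf{T}_a\to\mathbf{T}_{\mathrm{eq}}$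 forgets that $A$ and $a$ are distinguished. The functor $F_{\mathrm{exp}}\colon\mathbf{T}_{\mathrm{dec}}\to\mathbf{T}_A$. The projections from $A\times X$ are $\mathrm{pr}_X\colon A\times X\to A$ and $\varepsilon_X\colon A\times X\to X$. $F_{\mathrm{exp}}\Theta$ is the parameterized theory $\Theta_A$ generated by: the theory $\Theta_0$ (all types and pure terms of $\Theta$, with their identities, composites, chosen products and tuples, so that there is a morphism of theories $\Theta_0\to\Theta_A$), a new type $A$ (the distinguished one), and a term $f'\colon A\times X\to Y$ for each term $f\colon X\to Y$ of $\Theta$, subject to the relations: $f'=f\circ\varepsilon_X$ if $f$ is pure; $(g\circ f)'=g'\circ\langle \mathrm{pr}_X,f'\rangle$ for $f\colon X\to Y$, $g\colon Y\to Z$; and $\langle f_1,\dots,f_n\rangle'=\langle f_1',\dots,f_n'\rangle$ for all $n\ge 0$. That is, morphisms of theories $\Theta_A\to\Theta'$ correspond bijectively to a morphism of theories $\Theta_0\to\Theta'$, a type of $\Theta'$, and a family of terms of $\Theta'$ satisfying these relations. On a morphism $\varphi$ of decorated theories, $F_{\mathrm{exp}}\varphi$ sends $A$ to $A$, each pure $f$ to $\varphi(f)$ and each $f'$ to $\varphi(f)'$. The functor $F'_{\mathrm{exp}}\colon\mathbf{T}_{\mathrm{dec}}\to\mathbf{T}_a$ is the composite of $F_{\mathrm{exp}}$ with the functor $\mathbf{T}_A\to\mathbf{T}_a$ mapping $\gamma_A\colon\Pi_A\to\Theta_A$ to $\gamma_a\colon\Pi_a\to\Theta_a$, the pushout of $\gamma_A$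 along $i_A$ (so $\Theta_a$ is $\Theta_A$ with a freely added term $a\colon 1\to A$). For a decorated theory $\Theta$, $\Theta_a$ denotes the underlying theory of $F'_{\mathrm{exp}}\Theta$, which is a theory under $\Theta_0$. The morphism $J_\Theta\colon\Theta\to\Theta_a$ is the morphism of theories under $\Theta_0$ which maps each type $X$ to $X$ and each term $f\colon X\to Y$ to $f'\circ(a\times\mathrm{id}_X)\colon X\to Y$. -}

module Defs where

open import Level using (Level; _⊔_) renaming (suc to lsuc)
open import Data.Empty.Polymorphic using (⊥; ⊥-elim)
open import Data.Fin using (Fin; zero; suc)
open import Data.Nat using (ℕ; suc)
open import Data.Product using (Σ; _,_; proj₁; proj₂)
open import Data.Sum using (_⊎_; inj₁; inj₂)
open import Data.Unit.Polymorphic using (⊤; tt)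
open import Data.Vec using (Vec; []; _∷_; lookup; map)
open import Data.Vec.Properties using (lookup-map; map-id; map-∘)
open import Relation.Binary.PropositionalEquality as ≡ using (_≡_; refl; cong; cong₂; subst₂)
open import Relation.Binary.Structures using (IsEquivalence)

private variable
  o ℓ e o′ ℓ′ e′ : Level
  n : ℕ

record Category (o ℓ e : Level) : Set (lsuc (o ⊔ ℓ ⊔ e)) where
  infix  1 _⇒_
  infix  4 _≈_ _≅_
  infixr 9 _∘_
  field
    Obj : Set o
    _⇒_ : Obj → Obj → Set ℓ
    _≈_ : ∀ {X Y} → X ⇒ Y → X ⇒ Y → Set e
    id  : ∀ {X} → X ⇒ X
    _∘_ : ∀ {X Y Z} → Y ⇒ Z → X ⇒ Y → X ⇒ Z

    equiv     : ∀ {X Y} → IsEquivalence (_≈_ {X} {Y})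
    ∘-resp-≈  : ∀ {X Y Z} {g g′ : Y ⇒ Z} {f f′ : X ⇒ Y} → g ≈ g′ → f ≈ f′ → g ∘ f ≈ g′ ∘ f′
    identityˡ : ∀ {X Y} {f : X ⇒ Y} → id ∘ f ≈ f
    identityʳ : ∀ {X Y} {f : X ⇒ Y} → f ∘ id ≈ f
    assoc     : ∀ {W X Y Z} {h : Y ⇒ Z} {g : X ⇒ Y} {f : W ⇒ X} → (h ∘ g) ∘ f ≈ h ∘ (g ∘ f)

  module Equiv {X Y : Obj} = IsEquivalence (equiv {X} {Y})

  -- Equality of morphisms whose sources and targets are only propositionally
  -- equal.  Obj is a set by axiom K, so on a common hom-set this is just _≈_
  -- (see ≅⇒≈).
  data _≅_ {X Y : Obj} (f : X ⇒ Y) : ∀ {X′ Y′} → X′ ⇒ Y′ → Set (ℓ ⊔ e) where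
    het : {g : X ⇒ Y} → f ≈ g → f ≅ g

  ≅⇒≈ : ∀ {X Y} {f g : X ⇒ Y} → f ≅ g → f ≈ g
  ≅⇒≈ (het p) = p

  ≅-refl : ∀ {X Y} {f : X ⇒ Y} → f ≅ f
  ≅-refl = het Equiv.refl

  ≅-sym : ∀ {X Y X′ Y′} {f : X ⇒ Y} {g : X′ ⇒ Y′} → f ≅ g → g ≅ f
  ≅-sym (het p) = het (Equiv.sym p)

  infixr 5 _∙_
  _∙_ : ∀ {X Y X′ Y′ X″ Y″} {f : X ⇒ Y} {g : X′ ⇒ Y′} {h : X″ ⇒ Y″} → f ≅ g → g ≅ h → f ≅ h
  het p ∙ het q = het (Equiv.trans p q)

  ∘-cong : ∀ {X Y Z X′ Y′ Z′} {g : Y ⇒ Z} {f : X ⇒ Y} {g′ : Y′ ⇒ Z′} {f′ : X′ ⇒ Y′} →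
           g ≅ g′ → f ≅ f′ → g ∘ f ≅ g′ ∘ f′
  ∘-cong (het p) (het q) = het (∘-resp-≈ p q)

  id-cong : ∀ {X Y} → X ≡ Y → id {X} ≅ id {Y}
  id-cong refl = ≅-refl

  cast : ∀ {X Y X′ Y′} → X ≡ X′ → Y ≡ Y′ → X ⇒ Y → X′ ⇒ Y′
  cast = subst₂ _⇒_

  cast-≅ : ∀ {X Y X′ Y′} (p : X ≡ X′) (q : Y ≡ Y′) (f : X ⇒ Y) → cast p q f ≅ f
  cast-≅ refl refl f = ≅-refl

record Functor (C : Category o ℓ e) (D : Category o′ ℓ′ e′) : Set (o ⊔ ℓ ⊔ e ⊔ o′ ⊔ ℓ′ ⊔ e′) where
  private
    module C = Category C
    module D = Category D
  field
    F₀ : C.Obj → D.Obj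
    F₁ : ∀ {X Y} → X C.⇒ Y → F₀ X D.⇒ F₀ Y

    F-resp-≈     : ∀ {X Y} {f g : X C.⇒ Y} → f C.≈ g → F₁ f D.≈ F₁ g
    identity     : ∀ {X} → F₁ (C.id {X}) D.≈ D.id
    homomorphism : ∀ {X Y Z} {g : Y C.⇒ Z} {f : X C.⇒ Y} → F₁ (g C.∘ f) D.≈ F₁ g D.∘ F₁ f

  F-resp-≅ : ∀ {X Y X′ Y′} {f : X C.⇒ Y} {g : X′ C.⇒ Y′} → f C.≅ g → F₁ f D.≅ F₁ g
  F-resp-≅ (C.het p) = D.het (F-resp-≈ p)

idF : {C : Category o ℓ e} → Functor C C
idF {C = C} = record
  { F₀ = λ X → X
  ; F₁ = λ f → f
  ; F-resp-≈ = λ p → p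
  ; identity = Equiv.refl
  ; homomorphism = Equiv.refl
  }
  where open Category C

infixr 9 _∘F_
_∘F_ : ∀ {o″ ℓ″ e″} {B : Category o ℓ e} {C : Category o′ ℓ′ e′} {D : Category o″ ℓ″ e″} →
       Functor C D → Functor B C → Functor B D
_∘F_ {D = D} G F = record
  { F₀ = λ X → G.F₀ (F.F₀ X)
  ; F₁ = λ f → G.F₁ (F.F₁ f)
  ; F-resp-≈ = λ p → G.F-resp-≈ (F.F-resp-≈ p)
  ; identity = D.Equiv.trans (G.F-resp-≈ F.identity) G.identity
  ; homomorphism = D.Equiv.trans (G.F-resp-≈ F.homomorphism) G.homomorphism
  }
  where
    module F = Functor F
    module G = Functor G
    module D = Category D

record NaturalTransformation {C : Category o ℓ e} {D : Category o′ ℓ′ e′}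
                             (F G : Functor C D) : Set (o ⊔ ℓ ⊔ ℓ′ ⊔ e′) where
  private
    module C = Category C
    module F = Functor F
    module G = Functor G
  open Category D
  field
    component : ∀ X → F.F₀ X ⇒ G.F₀ X
    natural   : ∀ {X Y} (f : X C.⇒ Y) → G.F₁ f ∘ component X ≈ component Y ∘ F.F₁ f

infix 4 _≡F_
record _≡F_ {C : Category o ℓ e} {D : Category o′ ℓ′ e′} (F G : Functor C D) :
            Set (o ⊔ ℓ ⊔ o′ ⊔ ℓ′ ⊔ e′) where
  private
    module C = Category C
    module F = Functor F
    module G = Functor G
  open Category D
  field
    eq₀ : ∀ X → F.F₀ X ≡ G.F₀ X
    eq₁ : ∀ {X Y} (f : X C.⇒ Y) → F.F₁ f ≅ G.F₁ f

module Coslice (C : Category o ℓ e) (x : Category.Obj C) where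
  open Category C

  record Object : Set (o ⊔ ℓ) where
    constructor under
    field
      {target} : Obj
      arrow    : x ⇒ target
  open Object public

  record Morphism (a b : Object) : Set (ℓ ⊔ e) where
    constructor triangle
    field
      {mor}    : target a ⇒ target b
      commutes : mor ∘ arrow a ≈ arrow b
  open Morphism public

  coslice : Category (o ⊔ ℓ) (ℓ ⊔ e) e
  coslice = record
    { Obj = Object
    ; _⇒_ = Morphism
    ; _≈_ = λ f g → mor f ≈ mor g
    ; id = triangle identityˡ
    ; _∘_ = λ g f → triangle
        (Equiv.trans assoc (Equiv.trans (∘-resp-≈ Equiv.refl (commutes f)) (commutes g)))
    ; equiv = record { refl = Equiv.refl ; sym = Equiv.sym ; trans = Equiv.trans }
    ; ∘-resp-≈ = ∘-resp-≈
    ; identityˡ = identityˡ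
    ; identityʳ = identityʳ
    ; assoc = assoc
    }

  forget : Functor coslice C
  forget = record
    { F₀ = target
    ; F₁ = mor
    ; F-resp-≈ = λ p → p
    ; identity = Equiv.refl
    ; homomorphism = Equiv.refl
    }

record Pushout (C : Category o ℓ e) {x y z : Category.Obj C}
               (f : Category._⇒_ C x y) (g : Category._⇒_ C x z) : Set (o ⊔ ℓ ⊔ e) where
  open Category C
  field
    {corner} : Obj
    i₁       : y ⇒ corner
    i₂       : z ⇒ corner
    commute  : i₁ ∘ f ≈ i₂ ∘ g

    universal  : ∀ {w} {h : y ⇒ w} {k : z ⇒ w} → h ∘ f ≈ k ∘ g → corner ⇒ w
    universal₁ : ∀ {w} {h : y ⇒ w} {k : z ⇒ w} (p : h ∘ f ≈ k ∘ g) → universal p ∘ i₁ ≈ h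
    universal₂ : ∀ {w} {h : y ⇒ w} {k : z ⇒ w} (p : h ∘ f ≈ k ∘ g) → universal p ∘ i₂ ≈ k
    unique     : ∀ {w} {u v : corner ⇒ w} → u ∘ i₁ ≈ v ∘ i₁ → u ∘ i₂ ≈ v ∘ i₂ → u ≈ v

-- γ ↦ the pushout of γ along i, as a functor between coslices.
module Cobase (C : Category o ℓ e) {x y : Category.Obj C} (i : Category._⇒_ C x y)
              (po : ∀ {z} (γ : Category._⇒_ C x z) → Pushout C γ i) where
  open Category C
  private
    module X = Coslice C x
    module Y = Coslice C y
    module P {z} (γ : x ⇒ z) = Pushout (po γ)

  cobase₁ : ∀ {a b : X.Object} → X.Morphism a b →
            Y.Morphism (Y.under (P.i₂ (X.arrow a))) (Y.under (P.i₂ (X.arrow b)))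
  cobase₁ {a} {b} f = Y.triangle (P.universal₂ (X.arrow a) square)
    where
      square : (P.i₁ (X.arrow b) ∘ X.mor f) ∘ X.arrow a ≈ P.i₂ (X.arrow b) ∘ i
      square = Equiv.trans assoc
               (Equiv.trans (∘-resp-≈ Equiv.refl (X.commutes f)) (P.commute (X.arrow b)))

  cobase₁-i₁ : ∀ {a b : X.Object} (f : X.Morphism a b) →
               Y.mor (cobase₁ f) ∘ P.i₁ (X.arrow a) ≈ P.i₁ (X.arrow b) ∘ X.mor f
  cobase₁-i₁ {a} f = P.universal₁ (X.arrow a) _

  cobase : Functor X.coslice Y.coslice
  cobase = record
    { F₀ = λ a → Y.under (P.i₂ (X.arrow a))
    ; F₁ = cobase₁
    ; F-resp-≈ = λ {a} {b} {f} {g} p → P.unique (X.arrow a)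
        (Equiv.trans (cobase₁-i₁ f)
          (Equiv.trans (∘-resp-≈ Equiv.refl p) (Equiv.sym (cobase₁-i₁ g))))
        (Equiv.trans (Y.commutes (cobase₁ f)) (Equiv.sym (Y.commutes (cobase₁ g))))
    ; identity = λ {a} → P.unique (X.arrow a)
        (Equiv.trans (cobase₁-i₁ (Category.id X.coslice {a}))
          (Equiv.trans identityʳ (Equiv.sym identityˡ)))
        (Equiv.trans (Y.commutes (cobase₁ (Category.id X.coslice {a}))) (Equiv.sym identityˡ))
    ; homomorphism = λ {a} {b} {c} {g} {f} → P.unique (X.arrow a)
        (Equiv.trans (cobase₁-i₁ (Category._∘_ X.coslice g f))
          (Equiv.trans (Equiv.sym assoc)
            (Equiv.trans (∘-resp-≈ (Equiv.sym (cobase₁-i₁ g)) Equiv.refl)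
              (Equiv.trans assoc
                (Equiv.trans (∘-resp-≈ Equiv.refl (Equiv.sym (cobase₁-i₁ f)))
                  (Equiv.sym assoc))))))
        (Equiv.trans (Y.commutes (cobase₁ (Category._∘_ X.coslice g f)))
          (Equiv.sym (Y.commutes (Category._∘_ Y.coslice (cobase₁ g) (cobase₁ f)))))
    }

-- A product is chosen for every finite list of types; the chosen terminal type
-- is ∏ [], and the chosen binary product of X and Y is ∏ (X ∷ Y ∷ []).
record Theory (ℓ : Level) : Set (lsuc ℓ) where
  field
    category : Category ℓ ℓ ℓ
  open Category category public
  field
    ∏       : ∀ {n} → Vec Obj n → Obj
    π       : ∀ {n} (Ys : Vec Obj n) (i : Fin n) → ∏ Ys ⇒ lookup Ys i
    tuple   : ∀ {n X} (Ys : Vec Obj n) → (∀ i → X ⇒ lookup Ys i) → X ⇒ ∏ Ys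
    project : ∀ {n X} (Ys : Vec Obj n) (fs : ∀ i → X ⇒ lookup Ys i) i → π Ys i ∘ tuple Ys fs ≈ fs i
    unique  : ∀ {n X} (Ys : Vec Obj n) (fs : ∀ i → X ⇒ lookup Ys i) {h : X ⇒ ∏ Ys} →
              (∀ i → π Ys i ∘ h ≈ fs i) → h ≈ tuple Ys fs

  π-cong : ∀ {Xs Ys : Vec Obj n} → Xs ≡ Ys → ∀ i → π Xs i ≅ π Ys i
  π-cong refl i = ≅-refl

  tuple-cong : ∀ {X Y} {Xs Ys : Vec Obj n} {fs : ∀ i → X ⇒ lookup Xs i} {gs : ∀ i → Y ⇒ lookup Ys i} →
               X ≡ Y → Xs ≡ Ys → (∀ i → fs i ≅ gs i) → tuple Xs fs ≅ tuple Ys gs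
  tuple-cong {Xs = Xs} refl refl p =
    het (unique Xs _ λ i → Equiv.trans (project Xs _ i) (≅⇒≈ (p i)))

  unique-≅ : ∀ {X X′ W} (Ys : Vec Obj n) (fs : ∀ i → X ⇒ lookup Ys i) {h : X′ ⇒ W}
             (p : X′ ≡ X) (q : W ≡ ∏ Ys) → (∀ i → π Ys i ∘ cast p q h ≅ fs i) → h ≅ tuple Ys fs
  unique-≅ Ys fs p q r = ≅-sym (cast-≅ p q _) ∙ het (unique Ys fs λ i → ≅⇒≈ (r i))

-- The two-element family (f , g), for a family H of sets indexed by objects.
pair : ∀ {a b} {O : Set a} (H : O → Set b) {Y Z : O} → H Y → H Z → ∀ i → H (lookup (Y ∷ Z ∷ []) i)
pair H f g zero       = f
pair H f g (suc zero) = g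

-- Morphisms of theories preserve the chosen products on the nose.
infix 1 _⟶_
record _⟶_ (Θ Θ′ : Theory ℓ) : Set ℓ where
  private
    module Θ = Theory Θ
    module Θ′ = Theory Θ′
  field
    functor : Functor Θ.category Θ′.category
  open Functor functor public
  field
    F₀-∏ : ∀ {n} (Ys : Vec Θ.Obj n) → F₀ (Θ.∏ Ys) ≡ Θ′.∏ (map F₀ Ys)
    F₁-π : ∀ {n} (Ys : Vec Θ.Obj n) i → F₁ (Θ.π Ys i) Θ′.≅ Θ′.π (map F₀ Ys) i

  F₁-tuple : ∀ {X X′} (Ys : Vec Θ.Obj n) {Zs} (fs : ∀ i → X Θ.⇒ lookup Ys i)
             (gs : ∀ i → X′ Θ′.⇒ lookup Zs i) → F₀ X ≡ X′ → map F₀ Ys ≡ Zs →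
             (∀ i → F₁ (fs i) Θ′.≅ gs i) → F₁ (Θ.tuple Ys fs) Θ′.≅ Θ′.tuple Zs gs
  F₁-tuple Ys fs gs refl refl p = Θ′.unique-≅ _ gs refl (F₀-∏ Ys) λ i →
    Θ′.∘-cong (Θ′.≅-sym (F₁-π Ys i)) (Θ′.cast-≅ refl (F₀-∏ Ys) _)
    Θ′.∙ Θ′.≅-sym (Θ′.het homomorphism)
    Θ′.∙ Θ′.het (F-resp-≈ (Θ.project Ys fs i))
    Θ′.∙ p i

open _⟶_ using (functor)

idT : {Θ : Theory ℓ} → Θ ⟶ Θ
idT {Θ = Θ} = record
  { functor = idF
  ; F₀-∏ = λ Ys → cong ∏ (≡.sym (map-id Ys))
  ; F₁-π = λ Ys → π-cong (≡.sym (map-id Ys))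
  }
  where open Theory Θ

infixr 9 _∘T_
_∘T_ : {Θ Θ′ Θ″ : Theory ℓ} → Θ′ ⟶ Θ″ → Θ ⟶ Θ′ → Θ ⟶ Θ″
_∘T_ {Θ″ = Θ″} G F = record
  { functor = functor G ∘F functor F
  ; F₀-∏ = λ Ys → ≡.trans (cong G.F₀ (F.F₀-∏ Ys))
                  (≡.trans (G.F₀-∏ _) (cong ∏ (≡.sym (map-∘ G.F₀ F.F₀ Ys))))
  ; F₁-π = λ Ys i → G.F-resp-≅ (F.F₁-π Ys i) ∙ G.F₁-π _ i ∙ π-cong (≡.sym (map-∘ G.F₀ F.F₀ Ys)) i
  }
  where
    open Theory Θ″
    module F = _⟶_ F
    module G = _⟶_ G

module _ {Θ Θ′ : Theory ℓ} where
  open Theory Θ′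
  open _≡F_

  infix 4 _≡T_
  _≡T_ : (F G : Θ ⟶ Θ′) → Set ℓ
  F ≡T G = functor F ≡F functor G

  ≡T-refl : {F : Θ ⟶ Θ′} → F ≡T F
  ≡T-refl = record { eq₀ = λ X → refl ; eq₁ = λ f → ≅-refl }

  ≡T-sym : {F G : Θ ⟶ Θ′} → F ≡T G → G ≡T F
  ≡T-sym p = record { eq₀ = λ X → ≡.sym (eq₀ p X) ; eq₁ = λ f → ≅-sym (eq₁ p f) }

  ≡T-trans : {F G H : Θ ⟶ Θ′} → F ≡T G → G ≡T H → F ≡T H
  ≡T-trans p q = record
    { eq₀ = λ X → ≡.trans (eq₀ p X) (eq₀ q X)
    ; eq₁ = λ f → eq₁ p f ∙ eq₁ q f
    }

∘T-resp : {Θ Θ′ Θ″ : Theory ℓ} {G G′ : Θ′ ⟶ Θ″} {F F′ : Θ ⟶ Θ′} →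
          G ≡T G′ → F ≡T F′ → G ∘T F ≡T G′ ∘T F′
∘T-resp {Θ″ = Θ″} {G} {G′} {F} {F′} p q = record
  { eq₀ = λ X → ≡.trans (cong (_⟶_.F₀ G) (eq₀ q X)) (eq₀ p _)
  ; eq₁ = λ f → _⟶_.F-resp-≅ G (eq₁ q f) ∙ eq₁ p _
  }
  where
    open Theory Θ″
    open _≡F_

Teq : ∀ ℓ → Category (lsuc ℓ) ℓ ℓ
Teq ℓ = record
  { Obj = Theory ℓ
  ; _⇒_ = _⟶_
  ; _≈_ = _≡T_
  ; id = idT
  ; _∘_ = _∘T_
  ; equiv = λ {Θ} {Θ′} → record
    { refl = λ {F} → ≡T-refl {F = F}
    ; sym = λ {F} {G} → ≡T-sym {F = F} {G}
    ; trans = λ {F} {G} {H} → ≡T-trans {F = F} {G} {H}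
    }
  ; ∘-resp-≈ = λ {_} {_} {_} {G} {G′} {F} {F′} → ∘T-resp {G = G} {G′} {F} {F′}
  ; identityˡ = record { eq₀ = λ _ → refl ; eq₁ = λ _ → Category.≅-refl _ }
  ; identityʳ = record { eq₀ = λ _ → refl ; eq₁ = λ _ → Category.≅-refl _ }
  ; assoc = record { eq₀ = λ _ → refl ; eq₁ = λ _ → Category.≅-refl _ }
  }

record DecoratedTheory (ℓ : Level) : Set (lsuc ℓ) where
  field
    theory : Theory ℓ
  open Theory theory public
  field
    Pure        : ∀ {X Y} → X ⇒ Y → Set ℓ
    pure-resp-≈ : ∀ {X Y} {f g : X ⇒ Y} → f ≈ g → Pure f → Pure g
    pure-id     : ∀ {X} → Pure (id {X})
    pure-∘      : ∀ {X Y Z} {g : Y ⇒ Z} {f : X ⇒ Y} → Pure g → Pure f → Pure (g ∘ f)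
    pure-π      : ∀ {n} (Ys : Vec Obj n) i → Pure (π Ys i)
    pure-tuple  : ∀ {n X} (Ys : Vec Obj n) (fs : ∀ i → X ⇒ lookup Ys i) →
                  (∀ i → Pure (fs i)) → Pure (tuple Ys fs)

  -- The wide subtheory Θ₀.
  pureTheory : Theory ℓ
  pureTheory = record
    { category = record
      { Obj = Obj
      ; _⇒_ = λ X Y → Σ (X ⇒ Y) Pure
      ; _≈_ = λ f g → proj₁ f ≈ proj₁ g
      ; id = id , pure-id
      ; _∘_ = λ (g , q) (f , p) → g ∘ f , pure-∘ q p
      ; equiv = record { refl = Equiv.refl ; sym = Equiv.sym ; trans = Equiv.trans }
      ; ∘-resp-≈ = ∘-resp-≈
      ; identityˡ = identityˡ
      ; identityʳ = identityʳ
      ; assoc = assoc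
      }
    ; ∏ = ∏
    ; π = λ Ys i → π Ys i , pure-π Ys i
    ; tuple = λ Ys fs → tuple Ys (λ i → proj₁ (fs i)) , pure-tuple Ys _ (λ i → proj₂ (fs i))
    ; project = λ Ys fs → project Ys (λ i → proj₁ (fs i))
    ; unique = λ Ys fs → unique Ys (λ i → proj₁ (fs i))
    }

  pure-≅ : ∀ {X Y X′ Y′} {f : X ⇒ Y} {g : X′ ⇒ Y′} (p : Pure f) (q : Pure g) →
           f ≅ g → Theory._≅_ pureTheory (f , p) (g , q)
  pure-≅ p q (het r) = Category.het r

  pure⟶ : pureTheory ⟶ theory
  pure⟶ = record
    { functor = record
      { F₀ = λ X → X
      ; F₁ = proj₁
      ; F-resp-≈ = λ p → p
      ; identity = Equiv.refl
      ; homomorphism = Equiv.refl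
      }
    ; F₀-∏ = λ Ys → cong ∏ (≡.sym (map-id Ys))
    ; F₁-π = λ Ys → π-cong (≡.sym (map-id Ys))
    }

infix 1 _⟶ᵈ_
record _⟶ᵈ_ (Θ Θ′ : DecoratedTheory ℓ) : Set ℓ where
  private
    module Θ = DecoratedTheory Θ
    module Θ′ = DecoratedTheory Θ′
  field
    morphism       : Θ.theory ⟶ Θ′.theory
  open _⟶_ morphism public
  field
    preserves-pure : ∀ {X Y} {f : X Θ.⇒ Y} → Θ.Pure f → Θ′.Pure (F₁ f)

  pure-part : Θ.pureTheory ⟶ Θ′.pureTheory
  pure-part = record
    { functor = record
      { F₀ = F₀
      ; F₁ = λ (f , p) → F₁ f , preserves-pure p
      ; F-resp-≈ = F-resp-≈
      ; identity = identity
      ; homomorphism = homomorphism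
      }
    ; F₀-∏ = F₀-∏
    ; F₁-π = λ Ys i → Θ′.pure-≅ (preserves-pure (Θ.pure-π Ys i)) (Θ′.pure-π (map F₀ Ys) i) (F₁-π Ys i)
    }

open _⟶ᵈ_ using (morphism; preserves-pure)

Tdec : ∀ ℓ → Category (lsuc ℓ) ℓ ℓ
Tdec ℓ = record
  { Obj = DecoratedTheory ℓ
  ; _⇒_ = _⟶ᵈ_
  ; _≈_ = λ φ ψ → morphism φ ≡T morphism ψ
  ; id = record { morphism = idT ; preserves-pure = λ p → p }
  ; _∘_ = λ ψ φ → record
    { morphism = morphism ψ ∘T morphism φ
    ; preserves-pure = λ p → preserves-pure ψ (preserves-pure φ p)
    }
  ; equiv = λ {Θ} {Θ′} → record
    { refl = λ {φ} → ≡T-refl {F = morphism φ}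
    ; sym = λ {φ} {ψ} → ≡T-sym {F = morphism φ} {morphism ψ}
    ; trans = λ {φ} {ψ} {χ} → ≡T-trans {F = morphism φ} {morphism ψ} {morphism χ}
    }
  ; ∘-resp-≈ = λ {_} {_} {_} {ψ} {ψ′} {φ} {φ′} →
      ∘T-resp {G = morphism ψ} {morphism ψ′} {morphism φ} {morphism φ′}
  ; identityˡ = record { eq₀ = λ _ → refl ; eq₁ = λ _ → Category.≅-refl _ }
  ; identityʳ = record { eq₀ = λ _ → refl ; eq₁ = λ _ → Category.≅-refl _ }
  ; assoc = record { eq₀ = λ _ → refl ; eq₁ = λ _ → Category.≅-refl _ }
  }

H : Functor (Tdec ℓ) (Teq ℓ)
H = record
  { F₀ = DecoratedTheory.theory
  ; F₁ = morphism
  ; F-resp-≈ = λ p → p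
  ; identity = record { eq₀ = λ _ → refl ; eq₁ = λ _ → Category.≅-refl _ }
  ; homomorphism = record { eq₀ = λ _ → refl ; eq₁ = λ _ → Category.≅-refl _ }
  }

-- Types, Terms and Generated construct the theory generated by a theory B, a
-- set S of new types, a family G of new terms and a family R of relations.

-- The types form the ∏-algebra generated by that of B and by S.  Since ∏ of old
-- types is their product in B, the new types are the new generators and the
-- formal products of a vector with at least one new component.
module Types (B : Theory ℓ) (S : Set ℓ) where
  private
    module B = Theory B

  mutual
    data Ty : Set ℓ where
      old : B.Obj → Ty
      new : New → Ty

    data New : Set ℓ where
      atom : S → New
      prod : ∀ {n} → Mixed n → New

    -- Vectors of types whose first new component is marked by here.
    data Mixed : ℕ → Set ℓ where
      here  : ∀ {n} → New → Vec Ty n → Mixed (suc n)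
      there : ∀ {n} → B.Obj → Mixed n → Mixed (suc n)

  cons : B.Obj → Vec B.Obj n ⊎ Mixed n → Vec B.Obj (suc n) ⊎ Mixed (suc n)
  cons X (inj₁ Xs) = inj₁ (X ∷ Xs)
  cons X (inj₂ M)  = inj₂ (there X M)

  split : Vec Ty n → Vec B.Obj n ⊎ Mixed n
  split []           = inj₁ []
  split (old X ∷ Ps) = cons X (split Ps)
  split (new N ∷ Ps) = inj₂ (here N Ps)

  join : Vec B.Obj n ⊎ Mixed n → Ty
  join (inj₁ Xs) = old (B.∏ Xs)
  join (inj₂ M)  = new (prod M)

  ∏ : Vec Ty n → Ty
  ∏ Ps = join (split Ps)

  split-old : (Xs : Vec B.Obj n) → split (map old Xs) ≡ inj₁ Xs
  split-old []       = refl
  split-old (X ∷ Xs) = cong (cons X) (split-old Xs)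

  ∏-old : (Xs : Vec B.Obj n) → old (B.∏ Xs) ≡ ∏ (map old Xs)
  ∏-old Xs = cong join (≡.sym (split-old Xs))

  lookup-old : (Xs : Vec B.Obj n) (i : Fin n) → old (lookup Xs i) ≡ lookup (map old Xs) i
  lookup-old Xs i = ≡.sym (lookup-map i old Xs)

  toVec : Mixed n → Vec Ty n
  toVec (here N Ps) = new N ∷ Ps
  toVec (there X M) = old X ∷ toVec M

  split-toVec : (M : Mixed n) → split (toVec M) ≡ inj₂ M
  split-toVec (here N Ps) = refl
  split-toVec (there X M) = cong (cons X) (split-toVec M)

  ∏-toVec : (M : Mixed n) → ∏ (toVec M) ≡ new (prod M)
  ∏-toVec M = cong join (split-toVec M)

  module ⟦Types⟧ {D : Theory ℓ} (F : B ⟶ D) (s : S → Theory.Obj D) where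
    private
      module D = Theory D
      module F = _⟶_ F

    mutual
      ⟦_⟧ : Ty → D.Obj
      ⟦ old X ⟧ = F.F₀ X
      ⟦ new N ⟧ = ⟦ N ⟧ⁿ

      ⟦_⟧ⁿ : New → D.Obj
      ⟦ atom x ⟧ⁿ = s x
      ⟦ prod M ⟧ⁿ = D.∏ ⟦ M ⟧ᵐ

      ⟦_⟧ᵐ : Mixed n → Vec D.Obj n
      ⟦ here N Ps ⟧ᵐ = ⟦ N ⟧ⁿ ∷ ⟦ Ps ⟧ᵛ
      ⟦ there X M ⟧ᵐ = F.F₀ X ∷ ⟦ M ⟧ᵐ

      ⟦_⟧ᵛ : Vec Ty n → Vec D.Obj n
      ⟦ [] ⟧ᵛ     = []
      ⟦ P ∷ Ps ⟧ᵛ = ⟦ P ⟧ ∷ ⟦ Ps ⟧ᵛ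

    ⟦⟧ᵛ-map : (Ps : Vec Ty n) → ⟦ Ps ⟧ᵛ ≡ map ⟦_⟧ Ps
    ⟦⟧ᵛ-map []       = refl
    ⟦⟧ᵛ-map (P ∷ Ps) = cong (⟦ P ⟧ ∷_) (⟦⟧ᵛ-map Ps)

    ⟦_⟧ˢ : Vec B.Obj n ⊎ Mixed n → Vec D.Obj n
    ⟦ inj₁ Xs ⟧ˢ = map F.F₀ Xs
    ⟦ inj₂ M ⟧ˢ  = ⟦ M ⟧ᵐ

    ⟦⟧-cons : ∀ X (v : Vec B.Obj n ⊎ Mixed n) → ⟦ cons X v ⟧ˢ ≡ F.F₀ X ∷ ⟦ v ⟧ˢ
    ⟦⟧-cons X (inj₁ Xs) = refl
    ⟦⟧-cons X (inj₂ M)  = refl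

    ⟦⟧-split : (Ps : Vec Ty n) → ⟦ split Ps ⟧ˢ ≡ map ⟦_⟧ Ps
    ⟦⟧-split []           = refl
    ⟦⟧-split (old X ∷ Ps) = ≡.trans (⟦⟧-cons X (split Ps)) (cong (F.F₀ X ∷_) (⟦⟧-split Ps))
    ⟦⟧-split (new N ∷ Ps) = cong (⟦ N ⟧ⁿ ∷_) (⟦⟧ᵛ-map Ps)

    ⟦⟧-join : (v : Vec B.Obj n ⊎ Mixed n) → ⟦ join v ⟧ ≡ D.∏ ⟦ v ⟧ˢ
    ⟦⟧-join (inj₁ Xs) = F.F₀-∏ Xs
    ⟦⟧-join (inj₂ M)  = refl

    ⟦⟧-∏ : (Ps : Vec Ty n) → ⟦ ∏ Ps ⟧ ≡ D.∏ (map ⟦_⟧ Ps)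
    ⟦⟧-∏ Ps = ≡.trans (⟦⟧-join (split Ps)) (cong D.∏ (⟦⟧-split Ps))

module Terms (B : Theory ℓ) (S : Set ℓ) (G : Types.Ty B S → Types.Ty B S → Set ℓ) where
  private
    module B = Theory B
  open Types B S

  infixr 9 _∘ᵗ_
  data Tm : Ty → Ty → Set ℓ where
    old    : ∀ {X Y} → X B.⇒ Y → Tm (old X) (old Y)
    gen    : ∀ {P Q} → G P Q → Tm P Q
    idᵗ    : ∀ {P} → Tm P P
    _∘ᵗ_   : ∀ {P Q R} → Tm Q R → Tm P Q → Tm P R
    πᵗ     : ∀ {n} (Qs : Vec Ty n) i → Tm (∏ Qs) (lookup Qs i)
    tupleᵗ : ∀ {n P} (Qs : Vec Ty n) → (∀ i → Tm P (lookup Qs i)) → Tm P (∏ Qs)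

  module ⟦Terms⟧ {D : Theory ℓ} (F : B ⟶ D) (s : S → Theory.Obj D)
                 (g : ∀ {P Q} → G P Q → Theory._⇒_ D (⟦Types⟧.⟦_⟧ F s P) (⟦Types⟧.⟦_⟧ F s Q)) where
    private
      module F = _⟶_ F
    open Theory D hiding (∏)
    open ⟦Types⟧ F s public

    eval : ∀ {P Q} → Tm P Q → ⟦ P ⟧ ⇒ ⟦ Q ⟧
    eval (old f)        = F.F₁ f
    eval (gen x)        = g x
    eval idᵗ            = id
    eval (t ∘ᵗ u)       = eval t ∘ eval u
    eval (πᵗ Qs i)      = cast (≡.sym (⟦⟧-∏ Qs)) (lookup-map i ⟦_⟧ Qs) (π (map ⟦_⟧ Qs) i)
    eval (tupleᵗ Qs ts) = cast refl (≡.sym (⟦⟧-∏ Qs))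
      (tuple (map ⟦_⟧ Qs) (λ i → cast refl (≡.sym (lookup-map i ⟦_⟧ Qs)) (eval (ts i))))

    eval-π : (Qs : Vec Ty n) (i : Fin n) → eval (πᵗ Qs i) ≅ π (map ⟦_⟧ Qs) i
    eval-π Qs i = cast-≅ _ (lookup-map i ⟦_⟧ Qs) _

    eval-tuple : ∀ {P X} (Qs : Vec Ty n) (ts : ∀ i → Tm P (lookup Qs i)) {Ys}
                 {fs : ∀ i → X ⇒ lookup Ys i} → ⟦ P ⟧ ≡ X → map ⟦_⟧ Qs ≡ Ys →
                 (∀ i → eval (ts i) ≅ fs i) → eval (tupleᵗ Qs ts) ≅ tuple Ys fs
    eval-tuple Qs ts p q r = cast-≅ refl (≡.sym (⟦⟧-∏ Qs)) _
      ∙ tuple-cong p q (λ i → cast-≅ refl (≡.sym (lookup-map i ⟦_⟧ Qs)) _ ∙ r i)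

    eval-cast : ∀ {P Q P′ Q′} (p : P ≡ P′) (q : Q ≡ Q′) (t : Tm P Q) →
                eval (subst₂ Tm p q t) ≅ eval t
    eval-cast refl refl t = ≅-refl

module Generated (B : Theory ℓ) (S : Set ℓ) (G : Types.Ty B S → Types.Ty B S → Set ℓ)
                 (R : ∀ {P Q} → Terms.Tm B S G P Q → Terms.Tm B S G P Q → Set ℓ) where
  private
    module B = Theory B
  open Types B S
  open Terms B S G

  infix 4 _∼_
  data _∼_ : ∀ {P Q} → Tm P Q → Tm P Q → Set ℓ where
    relation : ∀ {P Q} {t u : Tm P Q} → R t u → t ∼ u

    old-resp : ∀ {X Y} {f g : X B.⇒ Y} → f B.≈ g → old f ∼ old g
    old-id   : ∀ {X} → old (B.id {X}) ∼ idᵗ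
    old-∘    : ∀ {X Y Z} {g : Y B.⇒ Z} {f : X B.⇒ Y} → old (g B.∘ f) ∼ old g ∘ᵗ old f
    old-π    : ∀ {n} (Xs : Vec B.Obj n) i →
               subst₂ Tm (∏-old Xs) (lookup-old Xs i) (old (B.π Xs i)) ∼ πᵗ (map old Xs) i

    refl∼     : ∀ {P Q} {t : Tm P Q} → t ∼ t
    sym∼      : ∀ {P Q} {t u : Tm P Q} → t ∼ u → u ∼ t
    trans∼    : ∀ {P Q} {t u v : Tm P Q} → t ∼ u → u ∼ v → t ∼ v
    ∘-resp∼   : ∀ {P Q R} {t t′ : Tm Q R} {u u′ : Tm P Q} → t ∼ t′ → u ∼ u′ → t ∘ᵗ u ∼ t′ ∘ᵗ u′
    identityˡ : ∀ {P Q} {t : Tm P Q} → idᵗ ∘ᵗ t ∼ t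
    identityʳ : ∀ {P Q} {t : Tm P Q} → t ∘ᵗ idᵗ ∼ t
    assoc     : ∀ {P Q R T} {t : Tm R T} {u : Tm Q R} {v : Tm P Q} → (t ∘ᵗ u) ∘ᵗ v ∼ t ∘ᵗ (u ∘ᵗ v)
    project   : ∀ {n P} (Qs : Vec Ty n) (ts : ∀ i → Tm P (lookup Qs i)) i →
                πᵗ Qs i ∘ᵗ tupleᵗ Qs ts ∼ ts i
    unique    : ∀ {n P} (Qs : Vec Ty n) (ts : ∀ i → Tm P (lookup Qs i)) {u : Tm P (∏ Qs)} →
                (∀ i → πᵗ Qs i ∘ᵗ u ∼ ts i) → u ∼ tupleᵗ Qs ts

  generated : Theory ℓ
  generated = record
    { category = record
      { Obj = Ty
      ; _⇒_ = Tm
      ; _≈_ = _∼_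
      ; id = idᵗ
      ; _∘_ = _∘ᵗ_
      ; equiv = record { refl = refl∼ ; sym = sym∼ ; trans = trans∼ }
      ; ∘-resp-≈ = ∘-resp∼
      ; identityˡ = identityˡ
      ; identityʳ = identityʳ
      ; assoc = assoc
      }
    ; ∏ = ∏
    ; π = πᵗ
    ; tuple = tupleᵗ
    ; project = project
    ; unique = unique
    }

  private
    module Gen = Theory generated

  base : B ⟶ generated
  base = record
    { functor = record
      { F₀ = old
      ; F₁ = old
      ; F-resp-≈ = old-resp
      ; identity = old-id
      ; homomorphism = old-∘
      }
    ; F₀-∏ = ∏-old
    ; F₁-π = λ Xs i → Gen.≅-sym (Gen.cast-≅ (∏-old Xs) (lookup-old Xs i) _) Gen.∙ Gen.het (old-π Xs i)
    }

  -- Extend and Unique together are the universal property of the generated theory.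
  module Extend {D : Theory ℓ} (F : B ⟶ D) (s : S → Theory.Obj D)
                (g : ∀ {P Q} → G P Q → Theory._⇒_ D (⟦Types⟧.⟦_⟧ F s P) (⟦Types⟧.⟦_⟧ F s Q))
                (r : ∀ {P Q} {t u : Tm P Q} → R t u →
                     Theory._≅_ D (⟦Terms⟧.eval F s g t) (⟦Terms⟧.eval F s g u)) where
    private
      module D = Theory D
      module F = _⟶_ F
      open D using (_∙_; ≅-sym; het; ∘-cong; ≅-refl)
    open ⟦Terms⟧ F s g

    private
      components : ∀ {P} {Qs : Vec Ty n} → (∀ i → Tm P (lookup Qs i)) →
                   ∀ i → ⟦ P ⟧ D.⇒ lookup (map ⟦_⟧ Qs) i
      components {Qs = Qs} ts i = D.cast refl (≡.sym (lookup-map i ⟦_⟧ Qs)) (eval (ts i))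

      components-≅ : ∀ {P} {Qs : Vec Ty n} (ts : ∀ i → Tm P (lookup Qs i)) i →
                     components {Qs = Qs} ts i D.≅ eval (ts i)
      components-≅ {Qs = Qs} ts i = D.cast-≅ refl (≡.sym (lookup-map i ⟦_⟧ Qs)) (eval (ts i))

    eval-resp : ∀ {P Q} {t u : Tm P Q} → t ∼ u → eval t D.≅ eval u
    eval-resp (relation x)   = r x
    eval-resp (old-resp p)   = het (F.F-resp-≈ p)
    eval-resp old-id         = het F.identity
    eval-resp old-∘          = het F.homomorphism
    eval-resp (old-π Xs i)   = eval-cast (∏-old Xs) (lookup-old Xs i) _
      ∙ F.F₁-π Xs i ∙ D.π-cong (map-∘ ⟦_⟧ old Xs) i ∙ ≅-sym (eval-π (map old Xs) i)
    eval-resp refl∼          = ≅-refl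
    eval-resp (sym∼ p)       = ≅-sym (eval-resp p)
    eval-resp (trans∼ p q)   = eval-resp p ∙ eval-resp q
    eval-resp (∘-resp∼ p q)  = ∘-cong (eval-resp p) (eval-resp q)
    eval-resp identityˡ      = het D.identityˡ
    eval-resp identityʳ      = het D.identityʳ
    eval-resp assoc          = het D.assoc
    eval-resp (project Qs ts i) =
      ∘-cong (eval-π Qs i) (eval-tuple Qs ts refl refl (λ j → ≅-sym (components-≅ {Qs = Qs} ts j)))
      ∙ het (D.project (map ⟦_⟧ Qs) (components {Qs = Qs} ts) i) ∙ components-≅ {Qs = Qs} ts i
    eval-resp (unique Qs ts {u} p) =
      D.unique-≅ (map ⟦_⟧ Qs) (components {Qs = Qs} ts) refl (⟦⟧-∏ Qs) (λ i →
        ∘-cong (≅-sym (eval-π Qs i)) (D.cast-≅ refl (⟦⟧-∏ Qs) (eval u))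
        ∙ eval-resp (p i) ∙ ≅-sym (components-≅ {Qs = Qs} ts i))
      ∙ ≅-sym (eval-tuple Qs ts refl refl (λ j → ≅-sym (components-≅ {Qs = Qs} ts j)))

    extend : generated ⟶ D
    extend = record
      { functor = record
        { F₀ = ⟦_⟧
        ; F₁ = eval
        ; F-resp-≈ = λ p → D.≅⇒≈ (eval-resp p)
        ; identity = D.Equiv.refl
        ; homomorphism = D.Equiv.refl
        }
      ; F₀-∏ = ⟦⟧-∏
      ; F₁-π = eval-π
      }

    extend-base : extend ∘T base ≡T F
    extend-base = record { eq₀ = λ X → refl ; eq₁ = λ f → ≅-refl }

  module Unique {D : Theory ℓ} (U V : generated ⟶ D) (same-base : U ∘T base ≡T V ∘T base)
                (same-atom : ∀ x → _⟶_.F₀ U (new (atom x)) ≡ _⟶_.F₀ V (new (atom x)))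
                (same-gen : ∀ {P Q} (x : G P Q) → Theory._≅_ D (_⟶_.F₁ U (gen x)) (_⟶_.F₁ V (gen x)))
                where
    private
      module D = Theory D
      module U = _⟶_ U
      module V = _⟶_ V
      open D using (_∙_; ≅-sym; het; ∘-cong)
      open _≡F_ same-base

    mutual
      same₀ : ∀ P → U.F₀ P ≡ V.F₀ P
      same₀ (old X)        = eq₀ X
      same₀ (new N)        = sameⁿ N

      sameⁿ : ∀ N → U.F₀ (new N) ≡ V.F₀ (new N)
      sameⁿ (atom x) = same-atom x
      sameⁿ (prod M) = begin
        U.F₀ (new (prod M))        ≡⟨ cong U.F₀ (∏-toVec M) ⟨
        U.F₀ (∏ (toVec M))         ≡⟨ U.F₀-∏ (toVec M) ⟩
        D.∏ (map U.F₀ (toVec M))   ≡⟨ cong D.∏ (sameᵐ M) ⟩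
        D.∏ (map V.F₀ (toVec M))   ≡⟨ V.F₀-∏ (toVec M) ⟨
        V.F₀ (∏ (toVec M))         ≡⟨ cong V.F₀ (∏-toVec M) ⟩
        V.F₀ (new (prod M))        ∎
        where open ≡.≡-Reasoning

      sameᵐ : (M : Mixed n) → map U.F₀ (toVec M) ≡ map V.F₀ (toVec M)
      sameᵐ (here N Ps) = cong₂ _∷_ (sameⁿ N) (sameᵛ Ps)
      sameᵐ (there X M) = cong₂ _∷_ (eq₀ X) (sameᵐ M)

      sameᵛ : (Ps : Vec Ty n) → map U.F₀ Ps ≡ map V.F₀ Ps
      sameᵛ []       = refl
      sameᵛ (P ∷ Ps) = cong₂ _∷_ (same₀ P) (sameᵛ Ps)

    same₁ : ∀ {P Q} (t : Tm P Q) → U.F₁ t D.≅ V.F₁ t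
    same₁ (old f)        = eq₁ f
    same₁ (gen x)        = same-gen x
    same₁ (idᵗ {P})      = het U.identity ∙ D.id-cong (same₀ P) ∙ ≅-sym (het V.identity)
    same₁ (t ∘ᵗ u)       = het U.homomorphism ∙ ∘-cong (same₁ t) (same₁ u) ∙ ≅-sym (het V.homomorphism)
    same₁ (πᵗ Qs i)      = U.F₁-π Qs i ∙ D.π-cong (sameᵛ Qs) i ∙ ≅-sym (V.F₁-π Qs i)
    same₁ (tupleᵗ {P = P} Qs ts) =
      U.F₁-tuple Qs ts components (same₀ P) (sameᵛ Qs) (λ i → same₁ (ts i) ∙ ≅-sym (components-≅ i))
      ∙ ≅-sym (V.F₁-tuple Qs ts components refl refl (λ i → ≅-sym (components-≅ i)))
      where
        components : ∀ i → V.F₀ P D.⇒ lookup (map V.F₀ Qs) i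
        components i = D.cast refl (≡.sym (lookup-map i V.F₀ Qs)) (V.F₁ (ts i))

        components-≅ : ∀ i → components i D.≅ V.F₁ (ts i)
        components-≅ i = D.cast-≅ refl (≡.sym (lookup-map i V.F₀ Qs)) (V.F₁ (ts i))

    same : U ≡T V
    same = record { eq₀ = same₀ ; eq₁ = same₁ }

-- The theory generated by nothing: all its types are products of terminal
-- types, so there is exactly one term between any two of them.
data Unital (ℓ : Level) : Set ℓ where
  ∏₀ : ∀ {n} → Vec (Unital ℓ) n → Unital ℓ

initial : Theory ℓ
initial {ℓ} = record
  { category = record
    { Obj = Unital ℓ
    ; _⇒_ = λ _ _ → ⊤
    ; _≈_ = λ _ _ → ⊤
    ; id = tt
    ; _∘_ = λ _ _ → tt
    ; equiv = record { refl = tt ; sym = λ _ → tt ; trans = λ _ _ → tt }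
    ; ∘-resp-≈ = λ _ _ → tt
    ; identityˡ = tt
    ; identityʳ = tt
    ; assoc = tt
    }
  ; ∏ = ∏₀
  ; π = λ _ _ → tt
  ; tuple = λ _ _ → tt
  ; project = λ _ _ _ → tt
  ; unique = λ _ _ _ → tt
  }

module Initial (D : Theory ℓ) where
  open Theory D

  mutual
    ¡₀ : Unital ℓ → Obj
    ¡₀ (∏₀ Ys) = ∏ (¡ᵛ Ys)

    ¡ᵛ : Vec (Unital ℓ) n → Vec Obj n
    ¡ᵛ []       = []
    ¡ᵛ (Y ∷ Ys) = ¡₀ Y ∷ ¡ᵛ Ys

  ¡ᵛ-map : (Ys : Vec (Unital ℓ) n) → ¡ᵛ Ys ≡ map ¡₀ Ys
  ¡ᵛ-map []       = refl
  ¡ᵛ-map (Y ∷ Ys) = cong (¡₀ Y ∷_) (¡ᵛ-map Ys)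

  mutual
    ! : ∀ {X} Y → X ⇒ ¡₀ Y
    ! (∏₀ Ys) = tuple (¡ᵛ Ys) (!ᵛ Ys)

    !ᵛ : ∀ {X} (Ys : Vec (Unital ℓ) n) i → X ⇒ lookup (¡ᵛ Ys) i
    !ᵛ (Y ∷ Ys) zero    = ! Y
    !ᵛ (Y ∷ Ys) (suc i) = !ᵛ Ys i

  mutual
    !-unique : ∀ {X} Y (f : X ⇒ ¡₀ Y) → f ≈ ! Y
    !-unique (∏₀ Ys) f = unique (¡ᵛ Ys) (!ᵛ Ys) (λ i → !ᵛ-unique Ys i _)

    !ᵛ-unique : ∀ {X} (Ys : Vec (Unital ℓ) n) i (f : X ⇒ lookup (¡ᵛ Ys) i) → f ≈ !ᵛ Ys i
    !ᵛ-unique (Y ∷ Ys) zero    f = !-unique Y f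
    !ᵛ-unique (Y ∷ Ys) (suc i) f = !ᵛ-unique Ys i f

  !-unique-≅ : ∀ {X X′ Y′} Y (f : X ⇒ ¡₀ Y) (g : X′ ⇒ Y′) → X ≡ X′ → ¡₀ Y ≡ Y′ → f ≅ g
  !-unique-≅ Y f g refl refl = het (Equiv.trans (!-unique Y f) (Equiv.sym (!-unique Y g)))

  ¡ : initial ⟶ D
  ¡ = record
    { functor = record
      { F₀ = ¡₀
      ; F₁ = λ {_} {Y} _ → ! Y
      ; F-resp-≈ = λ _ → Equiv.refl
      ; identity = λ {Y} → Equiv.sym (!-unique Y id)
      ; homomorphism = λ {_} {_} {Z} → Equiv.sym (!-unique Z _)
      }
    ; F₀-∏ = λ Ys → cong ∏ (¡ᵛ-map Ys)
    ; F₁-π = λ Ys i → !-unique-≅ (lookup Ys i) (! (lookup Ys i)) (π (map ¡₀ Ys) i)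
        (cong ∏ (¡ᵛ-map Ys)) (≡.sym (lookup-map i ¡₀ Ys))
    }

  module _ (F : initial ⟶ D) where
    private
      module F = _⟶_ F

    mutual
      ¡₀-unique : ∀ Y → ¡₀ Y ≡ F.F₀ Y
      ¡₀-unique (∏₀ Ys) = ≡.trans (cong ∏ (¡ᵛ-unique Ys)) (≡.sym (F.F₀-∏ Ys))

      ¡ᵛ-unique : (Ys : Vec (Unital ℓ) n) → ¡ᵛ Ys ≡ map F.F₀ Ys
      ¡ᵛ-unique []       = refl
      ¡ᵛ-unique (Y ∷ Ys) = cong₂ _∷_ (¡₀-unique Y) (¡ᵛ-unique Ys)

    ¡-unique : ¡ ≡T F
    ¡-unique = record
      { eq₀ = ¡₀-unique
      ; eq₁ = λ {X} {Y} f → !-unique-≅ Y (! Y) (F.F₁ f) (¡₀-unique X) (¡₀-unique Y)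
      }

  ¡-unique₂ : (F G : initial ⟶ D) → F ≡T G
  ¡-unique₂ F G = ≡T-trans {F = F} {¡} {G} (≡T-sym {F = ¡} {F} (¡-unique F)) (¡-unique G)

NoTerms : {T : Set ℓ} → T → T → Set ℓ
NoTerms _ _ = ⊥

NoRelations : ∀ {B : Theory ℓ} {S G P Q} → Terms.Tm B S G P Q → Terms.Tm B S G P Q → Set ℓ
NoRelations _ _ = ⊥

data Constant {B : Theory ℓ} {S : Set ℓ} (T : Types.Ty B S) :
              Types.Ty B S → Types.Ty B S → Set ℓ where
  constant : Constant T (Types.∏ B S []) T

-- The distinguished type of Π_A and of Π_a.
A₀ : Types.Ty (initial {ℓ}) ⊤
A₀ = Types.new (Types.atom tt)

module ΠA {ℓ} = Generated (initial {ℓ}) ⊤ NoTerms NoRelations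
module Πa {ℓ} = Generated (initial {ℓ}) ⊤ (Constant A₀) NoRelations

Π_A Π_a : Theory ℓ
Π_A = ΠA.generated
Π_a = Πa.generated

a₀ : Theory._⇒_ (Π_a {ℓ}) (Theory.∏ Π_a []) A₀
a₀ = Terms.gen constant

module _ (D : Theory ℓ) where
  open Theory D

  fromΠ_A : Obj → Π_A ⟶ D
  fromΠ_A X = E.extend
    where module E = ΠA.Extend (Initial.¡ D) (λ _ → X) (λ ()) (λ ())

  fromΠ_a : ∀ {X} → ∏ [] ⇒ X → Π_a ⟶ D
  fromΠ_a {X} a = E.extend
    where
      open Types.⟦Types⟧ initial ⊤ (Initial.¡ D) (λ _ → X) using (⟦_⟧)

      a′ : ∀ {P Q} → Constant A₀ P Q → ⟦ P ⟧ ⇒ ⟦ Q ⟧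
      a′ constant = a

      module E = Πa.Extend (Initial.¡ D) (λ _ → X) a′ (λ ())

module _ {D : Theory ℓ} where
  open Theory D

  Π_A-unique : (U V : Π_A ⟶ D) → _⟶_.F₀ U A₀ ≡ _⟶_.F₀ V A₀ → U ≡T V
  Π_A-unique U V p = ΠA.Unique.same U V (Initial.¡-unique₂ D (U ∘T ΠA.base) (V ∘T ΠA.base)) (λ _ → p) (λ ())

  Π_a-unique : (U V : Π_a ⟶ D) → _⟶_.F₀ U A₀ ≡ _⟶_.F₀ V A₀ → _⟶_.F₁ U a₀ ≅ _⟶_.F₁ V a₀ → U ≡T V
  Π_a-unique U V p q = Πa.Unique.same U V (Initial.¡-unique₂ D (U ∘T Πa.base) (V ∘T Πa.base)) (λ _ → p) (λ { constant → q })

i_A : Π_A {ℓ} ⟶ Π_a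
i_A = fromΠ_A Π_a A₀

-- The pushout of γ : Π_A ⟶ Θ along i_A: the theory Θ with an added constant of
-- type γ(A).
module Adjoin {Θ : Theory ℓ} (γ : Π_A ⟶ Θ) where
  private
    module Θ = Theory Θ
    module γ = _⟶_ γ
  open Types Θ ⊥ using (old)
  module Gen = Generated Θ ⊥ (Constant (old (γ.F₀ A₀))) NoRelations

  i₂ : Π_a ⟶ Gen.generated
  i₂ = fromΠ_a Gen.generated (Terms.gen constant)

  module _ {D : Theory ℓ} {h : Θ ⟶ D} {k : Π_a ⟶ D} (p : h ∘T γ ≡T k ∘T i_A) where
    private
      module h = _⟶_ h
      module k = _⟶_ k
      open Theory D
      open _≡F_ p

      source : k.F₀ (Theory.∏ Π_a []) ≡ h.F₀ (Θ.∏ [])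
      source = ≡.trans (k.F₀-∏ []) (≡.sym (h.F₀-∏ []))

      ka : h.F₀ (Θ.∏ []) ⇒ h.F₀ (γ.F₀ A₀)
      ka = cast source (≡.sym (eq₀ A₀)) (k.F₁ a₀)

      open Types.⟦Types⟧ Θ ⊥ h ⊥-elim using (⟦_⟧)

      ka′ : ∀ {P Q} → Constant (old (γ.F₀ A₀)) P Q → ⟦ P ⟧ ⇒ ⟦ Q ⟧
      ka′ constant = ka

      module E = Gen.Extend h ⊥-elim ka′ (λ ())

    universal : Gen.generated ⟶ D
    universal = E.extend

    universal₁ : universal ∘T Gen.base ≡T h
    universal₁ = E.extend-base

    universal₂ : universal ∘T i₂ ≡T k
    universal₂ = Π_a-unique (universal ∘T i₂) k (eq₀ A₀) (cast-≅ source (≡.sym (eq₀ A₀)) _)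

  pushout : Pushout (Teq ℓ) γ i_A
  pushout = record
    { i₁ = Gen.base
    ; i₂ = i₂
    ; commute = Π_A-unique (Gen.base ∘T γ) (i₂ ∘T i_A) refl
    ; universal = λ {_} {h} {k} → universal {h = h} {k}
    ; universal₁ = λ {_} {h} {k} → universal₁ {h = h} {k}
    ; universal₂ = λ {_} {h} {k} → universal₂ {h = h} {k}
    ; unique = λ {_} {u} {v} p q → Gen.Unique.same u v p (λ ()) (λ { constant → _≡F_.eq₁ q a₀ })
    }

module T_A {ℓ} = Coslice (Teq ℓ) Π_A
module T_a {ℓ} = Coslice (Teq ℓ) Π_a

TA Ta : ∀ ℓ → Category (lsuc ℓ) ℓ ℓ
TA ℓ = T_A.coslice
Ta ℓ = T_a.coslice

U′ : Functor (Ta ℓ) (Teq ℓ)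
U′ = T_a.forget

addConstant : Functor (TA ℓ) (Ta ℓ)
addConstant = Cobase.cobase (Teq _) i_A Adjoin.pushout

module Exp (Θ : DecoratedTheory ℓ) where
  open DecoratedTheory Θ
  open Types pureTheory ⊤ using (Ty; old; new; atom; ∏-old; lookup-old) renaming (∏ to ∏ᵗ)

  A : Ty
  A = new (atom tt)

  infixr 8 A×_
  A×_ : Ty → Ty
  A× P = ∏ᵗ (A ∷ P ∷ [])

  infix 10 _′
  data Prime : Ty → Ty → Set ℓ where
    _′ : ∀ {X Y} → X ⇒ Y → Prime (A× old X) (old Y)

  open Terms pureTheory ⊤ Prime

  prime : ∀ {X Y} → X ⇒ Y → Tm (A× old X) (old Y)
  prime f = gen (f ′)

  pr : ∀ X → Tm (A× old X) A
  pr X = πᵗ (A ∷ old X ∷ []) zero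

  ε : ∀ X → Tm (A× old X) (old X)
  ε X = πᵗ (A ∷ old X ∷ []) (suc zero)

  -- Θ_A is generated by Θ₀, the type A and a term f′ : A × X → Y for each term
  -- f : X → Y of Θ.  ′-resp makes f′ depend only on the equivalence class of f; the casts in
  -- ′-tuple identify the products of Θ₀ with those of Θ_A.
  data Relation : ∀ {P Q} → Tm P Q → Tm P Q → Set ℓ where
    ′-resp  : ∀ {X Y} {f g : X ⇒ Y} → f ≈ g → Relation (prime f) (prime g)
    ′-pure  : ∀ {X Y} {f : X ⇒ Y} (p : Pure f) → Relation (prime f) (old (f , p) ∘ᵗ ε X)
    ′-∘     : ∀ {X Y Z} (g : Y ⇒ Z) (f : X ⇒ Y) →
              Relation (prime (g ∘ f))
                       (prime g ∘ᵗ tupleᵗ (A ∷ old Y ∷ []) (pair (Tm (A× old X)) (pr X) (prime f)))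
    ′-tuple : ∀ {n X} (Ys : Vec Obj n) (fs : ∀ i → X ⇒ lookup Ys i) →
              Relation (subst₂ Tm refl (∏-old Ys) (prime (tuple Ys fs)))
                       (tupleᵗ (map old Ys) λ i →
                         subst₂ Tm refl (lookup-old Ys i) (prime (fs i)))

  open Generated pureTheory ⊤ Prime Relation public

  Θ_A : Theory ℓ
  Θ_A = generated

  γ_A : Π_A ⟶ Θ_A
  γ_A = fromΠ_A Θ_A A

  private
    module Gen = Theory generated

  prime-cong : ∀ {X Y X′ Y′} {f : X ⇒ Y} {g : X′ ⇒ Y′} → f ≅ g → prime f Gen.≅ prime g
  prime-cong (het p) = Gen.het (relation (′-resp p))

  old-cong : ∀ {X Y X′ Y′} {f : X ⇒ Y} {g : X′ ⇒ Y′} (p : Pure f) (q : Pure g) →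
             f ≅ g → old (f , p) Gen.≅ old (g , q)
  old-cong p q r = _⟶_.F-resp-≅ base (pure-≅ p q r)

module Exp₁ {Θ Θ′ : DecoratedTheory ℓ} (φ : Θ ⟶ᵈ Θ′) where
  private
    module Θ = DecoratedTheory Θ
    module Θ′ = DecoratedTheory Θ′
    module φ = _⟶ᵈ_ φ
    module E = Exp Θ
    module E′ = Exp Θ′
    open Theory E′.Θ_A using (_≅_; _∙_; ≅-sym; ≅-refl; het; ∘-cong; cast-≅; tuple-cong)
    open Types Θ.pureTheory ⊤ using (Ty; old; new; ∏-old; lookup-old)
    open Terms Θ.pureTheory ⊤ E.Prime using (Tm)

    base′ : Θ.pureTheory ⟶ E′.Θ_A
    base′ = E′.base ∘T φ.pure-part

    open Types.⟦Types⟧ Θ.pureTheory ⊤ base′ (λ _ → E′.A) using (⟦_⟧)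

    φ′ : ∀ {P Q} → E.Prime P Q → Theory._⇒_ E′.Θ_A ⟦ P ⟧ ⟦ Q ⟧
    φ′ (f E.′) = E′.prime (φ.F₁ f)

    open Terms.⟦Terms⟧ Θ.pureTheory ⊤ E.Prime base′ (λ _ → E′.A) φ′
      using (eval; eval-π; eval-tuple; eval-cast)

    rel : ∀ {P Q} {t u : Tm P Q} → E.Relation t u → eval t ≅ eval u
    rel (E.′-resp p) = E′.prime-cong (Θ′.het (φ.F-resp-≈ p))
    rel (E.′-pure {X} p) =
      het (E′.relation (E′.′-pure (φ.preserves-pure p)))
      ∙ ∘-cong ≅-refl (≅-sym (eval-π (E.A ∷ old X ∷ []) (suc zero)))
    rel (E.′-∘ {X} {Y} g f) =
      E′.prime-cong (Θ′.het φ.homomorphism)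
      ∙ het (E′.relation (E′.′-∘ (φ.F₁ g) (φ.F₁ f)))
      ∙ ∘-cong ≅-refl (≅-sym (eval-tuple (E.A ∷ old Y ∷ []) (pair (Tm (E.A× old X)) (E.pr X) (E.prime f)) refl refl λ
          { zero       → eval-π (E.A ∷ old X ∷ []) zero
          ; (suc zero) → ≅-refl }))
    rel (E.′-tuple {X = X} Ys fs) =
      eval-cast refl (∏-old Ys) (E.prime (Θ.tuple Ys fs))
      ∙ E′.prime-cong (φ.F₁-tuple Ys fs gs refl refl (λ i → Θ′.≅-sym (gs-≅ i)))
      ∙ ≅-sym (cast-≅ refl (E′-∏-old (map φ.F₀ Ys)) (E′.prime (Θ′.tuple _ gs)))
      ∙ het (E′.relation (E′.′-tuple (map φ.F₀ Ys) gs))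
      ∙ ≅-sym (eval-tuple (map old Ys) (λ i → subst₂ Tm refl (lookup-old Ys i) (E.prime (fs i))) refl maps λ i →
          eval-cast refl (lookup-old Ys i) (E.prime (fs i))
          ∙ E′.prime-cong (Θ′.≅-sym (gs-≅ i))
          ∙ ≅-sym (cast-≅ refl (E′-lookup-old (map φ.F₀ Ys) i) (E′.prime (gs i))))
      where
        open Types Θ′.pureTheory ⊤ using () renaming (∏-old to E′-∏-old; lookup-old to E′-lookup-old; old to old′)

        gs : ∀ i → φ.F₀ X Θ′.⇒ lookup (map φ.F₀ Ys) i
        gs i = Θ′.cast refl (≡.sym (lookup-map i φ.F₀ Ys)) (φ.F₁ (fs i))

        gs-≅ : ∀ i → gs i Θ′.≅ φ.F₁ (fs i)
        gs-≅ i = Θ′.cast-≅ refl (≡.sym (lookup-map i φ.F₀ Ys)) (φ.F₁ (fs i))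

        maps : map ⟦_⟧ (map old Ys) ≡ map old′ (map φ.F₀ Ys)
        maps = ≡.trans (≡.sym (map-∘ ⟦_⟧ old Ys)) (map-∘ old′ φ.F₀ Ys)

    module Ext = E.Extend base′ (λ _ → E′.A) φ′ rel

  φ_A : E.Θ_A ⟶ E′.Θ_A
  φ_A = Ext.extend

Fexp : Functor (Tdec ℓ) (TA ℓ)
Fexp = record
  { F₀ = λ Θ → T_A.under (Exp.γ_A Θ)
  ; F₁ = F₁
  ; F-resp-≈ = λ {Θ} {Θ′} {φ} {ψ} p →
      Exp.Unique.same Θ (Exp₁.φ_A φ) (Exp₁.φ_A ψ)
        (record
          { eq₀ = λ X → cong Types.old (_≡F_.eq₀ p X)
          ; eq₁ = λ (f , q) → Exp.old-cong Θ′ _ _ (_≡F_.eq₁ p f)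
          })
        (λ _ → refl)
        (λ { (f Exp.′) → Exp.prime-cong Θ′ (_≡F_.eq₁ p f) })
  ; identity = λ {Θ} → Exp.Unique.same Θ (Exp₁.φ_A (id {Θ})) idT
      (record { eq₀ = λ _ → refl ; eq₁ = λ _ → Category.≅-refl _ })
      (λ _ → refl)
      (λ { (f Exp.′) → Category.≅-refl _ })
  ; homomorphism = λ {Θ} {_} {_} {ψ} {φ} →
      Exp.Unique.same Θ (Exp₁.φ_A (ψ ∘ φ)) (Exp₁.φ_A ψ ∘T Exp₁.φ_A φ)
        (record { eq₀ = λ _ → refl ; eq₁ = λ _ → Category.≅-refl _ })
        (λ _ → refl)
        (λ { (f Exp.′) → Category.≅-refl _ })
  }
  where
    open Category (Tdec _) using (id; _∘_)
    F₁ : ∀ {Θ Θ′} → Θ ⟶ᵈ Θ′ → T_A.Morphism (T_A.under (Exp.γ_A Θ)) (T_A.under (Exp.γ_A Θ′))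
    F₁ {Θ} {Θ′} φ = T_A.triangle {mor = Exp₁.φ_A φ}
      (Π_A-unique (Exp₁.φ_A φ ∘T Exp.γ_A Θ) (Exp.γ_A Θ′) refl)

F′exp : Functor (Tdec ℓ) (Ta ℓ)
F′exp = addConstant ∘F Fexp

module _ (Θ : DecoratedTheory ℓ) where
  private
    module Θ = DecoratedTheory Θ
    module E = Exp Θ
    module F′ = Functor (F′exp {ℓ})

  Θ_a : Theory ℓ
  Θ_a = T_a.target (F′.F₀ Θ)

  open Theory Θ_a

  Θ_A⟶Θ_a : E.Θ_A ⟶ Θ_a
  Θ_A⟶Θ_a = Pushout.i₁ (Adjoin.pushout E.γ_A)

  Θ₀⟶Θ_a : Θ.pureTheory ⟶ Θ_a
  Θ₀⟶Θ_a = Θ_A⟶Θ_a ∘T E.base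

  private
    module ι = _⟶_ Θ₀⟶Θ_a

    A : Obj
    A = _⟶_.F₀ (T_a.arrow (F′.F₀ Θ)) A₀

  a : ∏ [] ⇒ A
  a = _⟶_.F₁ (T_a.arrow (F′.F₀ Θ)) a₀

  -- a × id_X precomposed with the canonical isomorphism X ≅ 1 × X.
  a×id : ∀ X → ι.F₀ X ⇒ ∏ (A ∷ ι.F₀ X ∷ [])
  a×id X = tuple (A ∷ ι.F₀ X ∷ []) (pair (ι.F₀ X ⇒_) (a ∘ tuple [] (λ ())) id)

  J₁ : ∀ {X Y} → X Θ.⇒ Y → ι.F₀ X ⇒ ι.F₀ Y
  J₁ {X} f = _⟶_.F₁ Θ_A⟶Θ_a (E.prime f) ∘ a×id X

  -- on-terms uses _≅_ because on-types is only a propositional equality.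
  record IsJ (j : Θ.theory ⟶ Θ_a) : Set ℓ where
    field
      on-types : ∀ X → _⟶_.F₀ j X ≡ ι.F₀ X
      on-terms : ∀ {X Y} (f : X Θ.⇒ Y) → _⟶_.F₁ j f ≅ J₁ f
      under-Θ₀ : j ∘T Θ.pure⟶ ≡T Θ₀⟶Θ_a

{-# OPTIONS --safe #-}

-- J preserves composition because ⟨ pr , f′ ⟩ ∘ (a × id) = (a × id) ∘ J f: both
-- sides have components a ∘ ! and J f.  By the relation for pure terms, J is the
-- canonical morphism on Θ₀, so it preserves identities and projections.  It is
-- natural in Θ because F′exp φ fixes a and maps f′ to φ(f)′.
module Submission where

open import Level using (Level)
open import Data.Fin using (zero; suc)
open import Data.Product using (Σ-syntax; _,_)
open import Data.Vec using (Vec; []; _∷_; lookup; map)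
open import Relation.Binary.Bundles using (Setoid)
open import Relation.Binary.PropositionalEquality using (_≡_; refl; cong)
import Relation.Binary.Reasoning.Setoid as ≈-Reasoning
open import Defs

private variable
  ℓ : Level

module _ (Θ : Theory ℓ) where
  open Theory Θ

  hom-setoid : Obj → Obj → Setoid ℓ ℓ
  hom-setoid X Y = record { isEquivalence = equiv {X} {Y} }

  terminal-unique : ∀ {X} (f g : X ⇒ ∏ []) → f ≈ g
  terminal-unique f g =
    Equiv.trans (unique [] (λ ()) (λ ())) (Equiv.sym (unique [] (λ ()) (λ ())))

  -- Both terms are the tuple of the components of `k`.
  unique₂ : ∀ {X} {Y Z : Obj} {h k : X ⇒ ∏ (Y ∷ Z ∷ [])} →
            π (Y ∷ Z ∷ []) zero ∘ h ≈ π (Y ∷ Z ∷ []) zero ∘ k →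
            π (Y ∷ Z ∷ []) (suc zero) ∘ h ≈ π (Y ∷ Z ∷ []) (suc zero) ∘ k → h ≈ k
  unique₂ {Y = Y} {Z} p q = Equiv.trans
    (unique (Y ∷ Z ∷ []) _ λ { zero → p ; (suc zero) → q })
    (Equiv.sym (unique (Y ∷ Z ∷ []) _ λ _ → Equiv.refl))

  -- The formula of `a×id` for any constant of any theory, so that its image under a morphism of
  -- theories can be computed.
  _×id : ∀ {A} → ∏ [] ⇒ A → ∀ X → X ⇒ ∏ (A ∷ X ∷ [])
  (c ×id) X = tuple (_ ∷ X ∷ []) (pair (X ⇒_) (c ∘ tuple [] (λ ())) id)

module _ {Θ Θ′ : Theory ℓ} (G : Θ ⟶ Θ′) where
  private
    module Θ = Theory Θ
    module G = _⟶_ G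
    open Theory Θ′

  -- Casting along `F₀-∏ []` makes the target the chosen terminal type, where parallel terms agree.
  F₁-terminal : ∀ {X} (f : X Θ.⇒ Θ.∏ []) (g : G.F₀ X ⇒ ∏ []) → G.F₁ f ≅ g
  F₁-terminal f g = ≅-sym (cast-≅ refl (G.F₀-∏ []) (G.F₁ f)) ∙ het (terminal-unique Θ′ _ g)

  F₁-×id : ∀ {A A′} (c : Θ.∏ [] Θ.⇒ A) {c′ : ∏ [] ⇒ A′} → G.F₀ A ≡ A′ → G.F₁ c ≅ c′ →
           ∀ X → G.F₁ (_×id Θ c X) ≅ _×id Θ′ c′ (G.F₀ X)
  F₁-×id {A} {A′} c {c′} p q X =
    G.F₁-tuple (A ∷ X ∷ []) fs gs refl (cong (_∷ G.F₀ X ∷ []) p) λ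
      { zero       → het G.homomorphism ∙ ∘-cong q (F₁-terminal ! !′)
      ; (suc zero) → het G.identity
      }
    where
      ! : X Θ.⇒ Θ.∏ []
      ! = Θ.tuple [] (λ ())

      !′ : G.F₀ X ⇒ ∏ []
      !′ = tuple [] (λ ())

      fs : ∀ i → X Θ.⇒ lookup (A ∷ X ∷ []) i
      fs = pair (X Θ.⇒_) (c Θ.∘ !) Θ.id

      gs : ∀ i → G.F₀ X ⇒ lookup (A′ ∷ G.F₀ X ∷ []) i
      gs = pair (G.F₀ X ⇒_) (c′ ∘ !′) id

module Interpretation (Θ : DecoratedTheory ℓ) where
  private
    module Θ = DecoratedTheory Θ
    module E = Exp Θ
    module i = _⟶_ (Θ_A⟶Θ_a Θ)
    module ι = _⟶_ (Θ₀⟶Θ_a Θ)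
    open Theory (Θ_a Θ)

    A : Obj
    A = i.F₀ E.A

    ! : ∀ {X} → X ⇒ ∏ []
    ! = tuple [] (λ ())

  pr-a×id : ∀ X → i.F₁ (E.pr X) ∘ a×id Θ X ≈ a Θ ∘ !
  pr-a×id X = Equiv.trans
    -- `≅⇒≈` applies because `∏` of two old types computes to the old product, so both projections
    -- lie in one hom-set.
    (∘-resp-≈ (≅⇒≈ (i.F₁-π _ zero)) Equiv.refl)
    (project (A ∷ ι.F₀ X ∷ []) _ zero)

  ε-a×id : ∀ X → i.F₁ (E.ε X) ∘ a×id Θ X ≈ id
  ε-a×id X = Equiv.trans
    (∘-resp-≈ (≅⇒≈ (i.F₁-π _ (suc zero))) Equiv.refl)
    (project (A ∷ ι.F₀ X ∷ []) _ (suc zero))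

  J₁-resp-≈ : ∀ {X Y} {f g : X Θ.⇒ Y} → f Θ.≈ g → J₁ Θ f ≈ J₁ Θ g
  J₁-resp-≈ p = ∘-resp-≈ (i.F-resp-≈ (E.relation (E.′-resp p))) Equiv.refl

  -- The relation `′-pure` replaces `f ′` by `f` after `ε`, and `ε` is a retraction of `a×id`.
  J₁-pure : ∀ {X Y} {f : X Θ.⇒ Y} (p : Θ.Pure f) → J₁ Θ f ≈ ι.F₁ (f , p)
  J₁-pure {X} p =
    Equiv.trans (∘-resp-≈ (i.F-resp-≈ (E.relation (E.′-pure p))) Equiv.refl)
    (Equiv.trans (∘-resp-≈ i.homomorphism Equiv.refl)
    (Equiv.trans assoc
    (Equiv.trans (∘-resp-≈ Equiv.refl (ε-a×id X)) identityʳ)))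

  module _ {X Y} (f : X Θ.⇒ Y) where
    private
      module Θ_A = Theory E.Θ_A

      Qs : Vec Θ_A.Obj 2
      Qs = E.A ∷ Types.old Y ∷ []

      components : ∀ j → (E.A× Types.old X) Θ_A.⇒ lookup Qs j
      components = pair ((E.A× Types.old X) Θ_A.⇒_) (E.pr X) (E.prime f)

    -- The coKleisli extension of `f ′` for the comonad A × -, which passes the parameter on; `′-∘`
    -- is coKleisli composition.
    shift : (E.A× Types.old X) Θ_A.⇒ (E.A× Types.old Y)
    shift = Θ_A.tuple Qs components

    shift-a×id : i.F₁ shift ∘ a×id Θ X ≈ a×id Θ Y ∘ J₁ Θ f
    shift-a×id = unique₂ (Θ_a Θ)
      (begin
        π Rs zero ∘ i.F₁ shift ∘ a×id Θ X          ≈⟨ left (i.F₁-π Qs zero) (Θ_A.project Qs components zero) ⟩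
        i.F₁ (E.pr X) ∘ a×id Θ X                   ≈⟨ pr-a×id X ⟩
        -- A constant ignores its context: precomposing `!` with `J₁ Θ f` gives `!` again.
        a Θ ∘ !                                    ≈⟨ ∘-resp-≈ Equiv.refl (terminal-unique (Θ_a Θ) _ _) ⟩
        a Θ ∘ ! ∘ J₁ Θ f                           ≈⟨ assoc ⟨
        (a Θ ∘ !) ∘ J₁ Θ f                         ≈⟨ right zero ⟨
        π Rs zero ∘ a×id Θ Y ∘ J₁ Θ f              ∎)
      (begin
        π Rs (suc zero) ∘ i.F₁ shift ∘ a×id Θ X    ≈⟨ left (i.F₁-π Qs (suc zero)) (Θ_A.project Qs components (suc zero)) ⟩
        J₁ Θ f                                     ≈⟨ identityˡ ⟨
        id ∘ J₁ Θ f                                ≈⟨ right (suc zero) ⟨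
        π Rs (suc zero) ∘ a×id Θ Y ∘ J₁ Θ f        ∎)
      where
        -- The ends stay implicit because the two chains live in different hom-sets.
        open module Reasoning {P Q} = ≈-Reasoning (hom-setoid (Θ_a Θ) P Q)

        Rs : Vec Obj 2
        Rs = map i.F₀ Qs

        -- The projection of `shift` is computed in `Θ_A` and carried over to `Θ_a`; `q` is the
        -- image of `p` as a projection there.
        left : ∀ {Z} {p : (E.A× Types.old Y) Θ_A.⇒ Z} {q : i.F₀ (E.A× Types.old Y) ⇒ i.F₀ Z}
               {c : (E.A× Types.old X) Θ_A.⇒ Z} → i.F₁ p ≅ q → p Θ_A.∘ shift Θ_A.≈ c →
               q ∘ i.F₁ shift ∘ a×id Θ X ≈ i.F₁ c ∘ a×id Θ X
        left r s = Equiv.trans (Equiv.sym assoc)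
          (∘-resp-≈ (Equiv.trans (∘-resp-≈ (Equiv.sym (≅⇒≈ r)) Equiv.refl)
                    (Equiv.trans (Equiv.sym i.homomorphism) (i.F-resp-≈ s))) Equiv.refl)

        right : ∀ j → π Rs j ∘ a×id Θ Y ∘ J₁ Θ f ≈ pair (ι.F₀ Y ⇒_) (a Θ ∘ !) id j ∘ J₁ Θ f
        right j = Equiv.trans (Equiv.sym assoc) (∘-resp-≈ (project Rs _ j) Equiv.refl)

  J₁-∘ : ∀ {X Y Z} (g : Y Θ.⇒ Z) (f : X Θ.⇒ Y) → J₁ Θ (g Θ.∘ f) ≈ J₁ Θ g ∘ J₁ Θ f
  J₁-∘ g f =
    Equiv.trans (∘-resp-≈ (i.F-resp-≈ (E.relation (E.′-∘ g f))) Equiv.refl)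
    (Equiv.trans (∘-resp-≈ i.homomorphism Equiv.refl)
    (Equiv.trans assoc
    (Equiv.trans (∘-resp-≈ Equiv.refl (shift-a×id f)) (Equiv.sym assoc))))

  J : Θ.theory ⟶ Θ_a Θ
  J = record
    { functor = record
      { F₀ = ι.F₀
      ; F₁ = J₁ Θ
      ; F-resp-≈ = J₁-resp-≈
      ; identity = Equiv.trans (J₁-pure Θ.pure-id) ι.identity
      ; homomorphism = J₁-∘ _ _
      }
    ; F₀-∏ = ι.F₀-∏
    ; F₁-π = λ Ys j → het (J₁-pure (Θ.pure-π Ys j)) ∙ ι.F₁-π Ys j
    }

  isJ : IsJ Θ J
  isJ = record
    { on-types = λ _ → refl
    ; on-terms = λ _ → ≅-refl
    ; under-Θ₀ = record { eq₀ = λ _ → refl ; eq₁ = λ (_ , p) → het (J₁-pure p) }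
    }

module Naturality {Θ Θ′ : DecoratedTheory ℓ} (φ : Θ ⟶ᵈ Θ′) where
  private
    module Θ = DecoratedTheory Θ
    module φ = _⟶ᵈ_ φ
    open Theory (Θ_a Θ′)

    φᵃ : T_a.Morphism (Functor.F₀ F′exp Θ) (Functor.F₀ F′exp Θ′)
    φᵃ = Functor.F₁ F′exp φ

    module φ_a = _⟶_ (T_a.mor φᵃ)

  -- `φᵃ` is a morphism under `Π_a`, so its triangle, read at the generic constant `a₀`, gives this.
  φ_a-a : φ_a.F₁ (a Θ) ≅ a Θ′
  φ_a-a = _≡F_.eq₁ (T_a.commutes φᵃ) a₀

  φ_a-J₁ : ∀ {X Y} (f : X Θ.⇒ Y) → φ_a.F₁ (J₁ Θ f) ≅ J₁ Θ′ (φ.F₁ f)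
  φ_a-J₁ {X} f = het (φ_a.homomorphism {g = _⟶_.F₁ (Θ_A⟶Θ_a Θ) (Exp.prime Θ f)} {f = a×id Θ X})
    -- The image of `f ′` evaluates to the primed image of `f`, so reflexivity handles the left
    -- factor; only `a×id` needs an argument.
    ∙ ∘-cong ≅-refl (F₁-×id (T_a.mor φᵃ) (a Θ) refl φ_a-a (_⟶_.F₀ (Θ₀⟶Θ_a Θ) X))

theorem3p9 : ∀ {ℓ : Level} →
    Σ[ J ∈ NaturalTransformation (H {ℓ}) (U′ ∘F F′exp) ]
    (∀ (Θ : DecoratedTheory ℓ) → IsJ Θ (NaturalTransformation.component J Θ))
theorem3p9 =
  record
    { component = Interpretation.J
    -- On types, both composites compute to the image of `φ` applied to the type.
    ; natural = λ φ → record { eq₀ = λ _ → refl ; eq₁ = Naturality.φ_a-J₁ φ }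
    } , Interpretation.isJ
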